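{- Let $r\in\mathbb{N}_0$. There is a constant $C$ depending only on $r$ such that the following holds. Let $H$ be a graph without isolated vertices, let $(G,c)$ be an $H$-coloured graph on $n$ vertices, and let $\rho$ be a fracture of $H^r$. Then the (underlying graph of the) tensor product $(G^r,c^r)\times(H^r\sharp\rho,c_\rho)$ is (isomorphic to) a subgraph of the $r$-subdivision of a complete graph of order at most $C\cdot k\cdot n$, where $k=|E(H)|$.
   Context: Graphs are finite, undirected, without self-loops. $G^r$ is the $r$-subdivision of $G$: each edge is replaced by a path with $r$ internal vertices ($r+1$ edges); $G^0=G$. An $H$-coloured graph is a pair $(G,c)$ with $c$ a homomorphism from $G$ to $H$. The induced $H^r$-colouring $c^r$ of $G^r$: $c^r(u)=c(u)$ for $u\in V(G)$; for an edge $\{u_1,u_2\}\in E(G)$ with corresponding path $u_1,w_1,\dots,w_r,u_2$ in $G^r$, and $v_1,x_1,\dots,x_r,v_2$ the path in $H^r$ corresponding to the edge $\{v_1,v_2\}=\{c(u_1),c(u_2)\}$ of $H$ with $v_1=c(u_1)$, $v_2=c(u_2)$, set $c^r(w_i)=x_i$. A fracture of a graph $F$ is a tuple $\rho=(\rho_v)_{v\in V(F)}$ where $\rho_v$ is a partition of the set of edges of $F$ incident to $v$. The fractured graph $F\sharp\rho$ has a vertex $v^B$ for each $v\in V(F)$ and each block $B\in\rho_v$, and $v^B$ and $u^{B'}$ are adjacent iff $\{u,v\}\in E(F)$ and $\{u,v\}\in B\cap B'$. The map $c_\rho:v^B\mapsto v$ is an $F$-colouring of $F\sharp\rho$. For $F$-coloured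 graphs $(G_1,c_1),(G_2,c_2)$, the tensor product $(G_1,c_1)\times(G_2,c_2)$ is the $F$-coloured graph $(\hat G,\hat c)$ with $V(\hat G)=\{(v_1,v_2)\in V(G_1)\times V(G_2): c_1(v_1)=c_2(v_2)\}$, $\{(u_1,u_2),(v_1,v_2)\}\in E(\hat G)$ iff $\{u_1,v_1\}\in E(G_1)$ and $\{u_2,v_2\}\in E(G_2)$, and $\hat c(v_1,v_2)=c_1(v_1)$. Here it is applied with $F=H^r$. -}

module Defs where

open import Data.Fin using (Fin; zero; suc; fromℕ; inject₁; opposite; _<_; _<?_)
open import Data.Fin.Properties using (_≟_; any?; <-cmp; <-asym; opposite-involutive; suc-injective)
open import Data.Fin.Relation.Unary.Top using (view; view-fromℕ; view-inject₁; ‵fromℕ; ‵inject₁)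
open import Data.List using (length; filter; allFin; cartesianProduct)
open import Data.Nat using (ℕ; zero; suc)
open import Data.Product using (Σ-syntax; ∃-syntax; _×_; _,_; proj₁; proj₂)
open import Data.Vec.Functional using (Vector; _∷_)
open import Function using (_∘_)
open import Function.Definitions using (Injective; StrictlySurjective)
open import Relation.Binary.Definitions using (Decidable; DecidableEquality; Irreflexive; Symmetric; tri<; tri≈; tri>)
open import Relation.Binary.PropositionalEquality using (_≡_; _≢_; refl; sym; trans; cong)
open import Relation.Nullary using (Dec; yes; no; ¬_; ¬?; contradiction; contradiction-irr; map′; _×-dec_)

-- Finite graphs are those of type `Graph (Fin n)`. Vertex types other than
-- `Fin n` arise only from the constructions below.
record Graph (V : Set) : Set₁ where
  field
    Adj    : V → V → Set
    symm   : Symmetric Adj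
    irrefl : Irreflexive _≡_ Adj
    adj?   : Decidable Adj

open Graph

record Hom {V W : Set} (G : Graph V) (H : Graph W) : Set where
  field
    map      : V → W
    preserve : ∀ {u v} → Adj G u v → Adj H (map u) (map v)

open Hom

-- G is isomorphic to a (not necessarily induced) subgraph of H.
_⊑_ : {V W : Set} → Graph V → Graph W → Set
G ⊑ H = Σ[ f ∈ Hom G H ] Injective _≡_ _≡_ (map f)

NoIsolatedVertices : {V : Set} → Graph V → Set
NoIsolatedVertices {V} G = (v : V) → ∃[ u ] Adj G v u

complete : ∀ n → Graph (Fin n)
complete n = record
  { Adj    = _≢_
  ; symm   = λ u≢v v≡u → u≢v (sym v≡u)
  ; irrefl = λ u≡v u≢v → u≢v u≡v
  ; adj?   = λ u v → ¬? (u ≟ v)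
  }

-- The unordered pair {u , v} is represented by its increasing ordering.
record Edge {n} (G : Graph (Fin n)) : Set where
  constructor edge
  field
    src tgt  : Fin n
    .src<tgt : src < tgt
    .adj     : Adj G src tgt

∣E_∣ : ∀ {n} → Graph (Fin n) → ℕ
∣E_∣ {n} G =
  length (filter (λ (u , v) → (u <? v) ×-dec adj? G u v)
                 (cartesianProduct (allFin n) (allFin n)))

-- For an edge e = {a , b} of G with a < b, `sub e i` is the (i+1)-st of the
-- r internal vertices met when going from a to b.
data SubdivisionVertex {n} (G : Graph (Fin n)) (r : ℕ) : Set where
  orig : Fin n → SubdivisionVertex G r
  sub  : Edge G → Fin r → SubdivisionVertex G r

_∷ʳ_ : ∀ {A : Set} {r} → Vector A r → A → Vector A (suc r)
(w ∷ʳ a) i with view i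
... | ‵fromℕ     = a
... | ‵inject₁ j = w j

module _ {A : Set} where

  ∷ʳ-fromℕ : ∀ {r} (w : Vector A r) a → (w ∷ʳ a) (fromℕ r) ≡ a
  ∷ʳ-fromℕ {r} w a rewrite view-fromℕ r = refl

  ∷ʳ-inject₁ : ∀ {r} (w : Vector A r) a j → (w ∷ʳ a) (inject₁ j) ≡ w j
  ∷ʳ-inject₁ w a j rewrite view-inject₁ j = refl

  ∷ʳ-map : ∀ {B : Set} {r} (f : A → B) (w : Vector A r) {w′ : Vector B r} a →
           (∀ j → f (w j) ≡ w′ j) → ∀ i → f ((w ∷ʳ a) i) ≡ (w′ ∷ʳ f a) i
  ∷ʳ-map f w a eq i with view i
  ... | ‵fromℕ     = refl
  ... | ‵inject₁ j = eq j

opposite-fromℕ : ∀ r → opposite (fromℕ r) ≡ zero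
opposite-fromℕ zero    = refl
opposite-fromℕ (suc r) = cong inject₁ (opposite-fromℕ r)

opposite-inject₁ : ∀ {r} (i : Fin r) → opposite (inject₁ i) ≡ suc (opposite i)
opposite-inject₁ zero    = refl
opposite-inject₁ (suc i) = cong inject₁ (opposite-inject₁ i)

inject₁≢suc : ∀ {r} (i : Fin r) → inject₁ i ≢ suc i
inject₁≢suc zero    ()
inject₁≢suc (suc i) eq = inject₁≢suc i (suc-injective eq)

reverse-path : ∀ {A : Set} {r} (a : A) (w : Vector A r) {w′ : Vector A r} b →
               (∀ j → w (opposite j) ≡ w′ j) →
               ∀ i → (a ∷ (w ∷ʳ b)) (opposite i) ≡ (b ∷ (w′ ∷ʳ a)) i
reverse-path a w b eq zero = ∷ʳ-fromℕ w b
reverse-path a w b eq (suc i) with view i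
reverse-path {r = r} a w b eq (suc .(fromℕ r)) | ‵fromℕ
  rewrite opposite-fromℕ r = refl
reverse-path a w b eq (suc .(inject₁ j)) | ‵inject₁ j
  rewrite opposite-inject₁ j = trans (∷ʳ-inject₁ w b (opposite j)) (eq j)

module _ {n} (G : Graph (Fin n)) {r : ℕ} where

  -- The internal vertices w₁ , … , wᵣ of the path replacing {u , v}, listed
  -- from u to v.
  internal : (u v : Fin n) → .(Adj G u v) → Vector (SubdivisionVertex G r) r
  internal u v uv i with <-cmp u v
  ... | tri< u<v _ _ = sub (edge u v u<v uv) i
  ... | tri≈ _ u≡v _ = contradiction-irr uv (irrefl G u≡v)
  ... | tri> _ _ v<u = sub (edge v u v<u (symm G uv)) (opposite i)

  path : (u v : Fin n) → .(Adj G u v) → Vector (SubdivisionVertex G r) (suc (suc r))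
  path u v uv = orig u ∷ (internal u v uv ∷ʳ orig v)

  internal-opposite : ∀ u v .(uv : Adj G u v) i →
                      internal u v uv (opposite i) ≡ internal v u (symm G uv) i
  internal-opposite u v uv i with <-cmp u v | <-cmp v u
  ... | tri< u<v _ _ | tri< v<u _ _ = contradiction v<u (<-asym u<v)
  ... | tri< _ _ _   | tri> _ _ _   = refl
  ... | tri> _ _ _   | tri< _ _ _   = cong (sub _) (opposite-involutive i)
  ... | tri> _ _ v<u | tri> _ _ u<v = contradiction v<u (<-asym u<v)
  ... | tri≈ _ u≡v _ | _            = contradiction-irr uv (irrefl G u≡v)
  ... | _            | tri≈ _ v≡u _ = contradiction-irr uv (irrefl G (sym v≡u))

  path-opposite : ∀ u v .(uv : Adj G u v) i →
                  path u v uv (opposite i) ≡ path v u (symm G uv) i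
  path-opposite u v uv =
    reverse-path (orig u) (internal u v uv) (orig v) (internal-opposite u v uv)

  orig≢internal : ∀ u v .(uv : Adj G u v) {x} i → orig x ≢ internal u v uv i
  orig≢internal u v uv i eq with <-cmp u v
  orig≢internal u v uv i () | tri< _ _ _
  ... | tri≈ _ u≡v _ = contradiction-irr uv (irrefl G u≡v)
  orig≢internal u v uv i () | tri> _ _ _

  sub-injectiveʳ : ∀ {e f : Edge G} {i j : Fin r} → sub {r = r} e i ≡ sub f j → i ≡ j
  sub-injectiveʳ refl = refl

  internal-injective : ∀ u v .(uv : Adj G u v) i j →
                       internal u v uv i ≡ internal u v uv j → i ≡ j
  internal-injective u v uv i j eq with <-cmp u v
  ... | tri< _ _ _   = sub-injectiveʳ eq
  ... | tri≈ _ u≡v _ = contradiction-irr uv (irrefl G u≡v)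
  ... | tri> _ _ _   =
    trans (sym (opposite-involutive i))
          (trans (cong opposite (sub-injectiveʳ eq)) (opposite-involutive j))

  orig-injective : ∀ {u v : Fin n} → orig {G = G} {r} u ≡ orig v → u ≡ v
  orig-injective refl = refl

  start≢later : ∀ u v (uv : Adj G u v) k → orig u ≢ (internal u v uv ∷ʳ orig v) k
  start≢later u v uv k eq with view k
  ... | ‵fromℕ     = irrefl G (orig-injective eq) uv
  ... | ‵inject₁ j = orig≢internal u v uv j eq

  internal≢later : ∀ u v (uv : Adj G u v) i k → inject₁ i ≢ k →
                   internal u v uv i ≢ (internal u v uv ∷ʳ orig v) k
  internal≢later u v uv i k i≢k eq with view k
  ... | ‵fromℕ     = orig≢internal u v uv i (sym eq)
  ... | ‵inject₁ j = i≢k (cong inject₁ (internal-injective u v uv i j eq))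

  path-steps-distinct : ∀ u v (uv : Adj G u v) i →
                        path u v uv (inject₁ i) ≢ path u v uv (suc i)
  path-steps-distinct u v uv zero    eq = start≢later u v uv zero eq
  path-steps-distinct u v uv (suc i) eq =
    internal≢later u v uv i (suc i) (inject₁≢suc i)
      (trans (sym (∷ʳ-inject₁ (internal u v uv) (orig v) i)) eq)

  _≟ˢ_ : DecidableEquality (SubdivisionVertex G r)
  orig u ≟ˢ orig v = map′ (cong orig) orig-injective (u ≟ v)
  orig _ ≟ˢ sub _ _ = no λ ()
  sub _ _ ≟ˢ orig _ = no λ ()
  sub (edge a b _ _) i ≟ˢ sub (edge c d _ _) j =
    map′ (λ { (refl , refl , refl) → refl }) (λ { refl → refl , refl , refl })
         ((a ≟ c) ×-dec (b ≟ d) ×-dec (i ≟ j))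

  -- x and y are consecutive on the path replacing some edge of G.
  SubdivisionAdj : (x y : SubdivisionVertex G r) → Set
  SubdivisionAdj x y =
    ∃[ u ] ∃[ v ] Σ[ uv ∈ Adj G u v ] Σ[ i ∈ Fin (suc r) ]
      (x ≡ path u v uv (inject₁ i) × y ≡ path u v uv (suc i))

  subdivision-symm : Symmetric SubdivisionAdj
  subdivision-symm (u , v , uv , i , x≡ , y≡) =
    v , u , symm G uv , opposite i ,
    trans y≡ (sym (path-opposite v u (symm G uv) (suc i))) ,
    trans x≡ (trans (sym (path-opposite v u (symm G uv) (inject₁ i)))
                    (cong (path v u (symm G uv)) (opposite-inject₁ i)))

  subdivision-adj? : Decidable SubdivisionAdj
  subdivision-adj? x y = any? λ u → any? λ v → step? u v
    where
    step? : ∀ u v → Dec (Σ[ uv ∈ Adj G u v ] Σ[ i ∈ Fin (suc r) ]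
                          (x ≡ path u v uv (inject₁ i) × y ≡ path u v uv (suc i)))
    step? u v with adj? G u v
    ... | no ¬uv = no (¬uv ∘ proj₁)
    ... | yes uv = map′ (uv ,_) proj₂
      (any? λ i → (x ≟ˢ path u v uv (inject₁ i)) ×-dec (y ≟ˢ path u v uv (suc i)))

infixl 20 _^_
_^_ : ∀ {n} (G : Graph (Fin n)) (r : ℕ) → Graph (SubdivisionVertex G r)
G ^ r = record
  { Adj    = SubdivisionAdj G
  ; symm   = subdivision-symm G
  ; irrefl = λ { x≡y (u , v , uv , i , x≡ , y≡) →
                 path-steps-distinct G u v uv i (trans (sym x≡) (trans x≡y y≡)) }
  ; adj?   = subdivision-adj? G
  }

record ColouredGraph {W : Set} (F : Graph W) : Set₁ where
  constructor coloured
  field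
    {Vertex}  : Set
    graph     : Graph Vertex
    colouring : Hom graph F

open ColouredGraph

module _ {m n} {G : Graph (Fin n)} {H : Graph (Fin m)} (c : Hom G H) (r : ℕ) where

  inducedMap : SubdivisionVertex G r → SubdivisionVertex H r
  inducedMap (orig u)                = orig (map c u)
  inducedMap (sub (edge u₁ u₂ _ e) i) = internal H (map c u₁) (map c u₂) (preserve c e) i

  inducedMap-internal : ∀ u v .(uv : Adj G u v) i →
                        inducedMap (internal G u v uv i) ≡
                        internal H (map c u) (map c v) (preserve c uv) i
  inducedMap-internal u v uv i with <-cmp u v
  ... | tri< _ _ _   = refl
  ... | tri≈ _ u≡v _ = contradiction-irr uv (irrefl G u≡v)
  ... | tri> _ _ _   =
    internal-opposite H (map c v) (map c u) (preserve c (symm G uv)) i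

  inducedMap-path : ∀ u v .(uv : Adj G u v) i →
                    inducedMap (path G u v uv i) ≡
                    path H (map c u) (map c v) (preserve c uv) i
  inducedMap-path u v uv zero    = refl
  inducedMap-path u v uv (suc i) =
    ∷ʳ-map inducedMap (internal G u v uv) (orig v) (inducedMap-internal u v uv) i

  inducedColouring : Hom (G ^ r) (H ^ r)
  inducedColouring = record
    { map      = inducedMap
    ; preserve = λ { (u , v , uv , i , refl , refl) →
        map c u , map c v , preserve c uv , i ,
        inducedMap-path u v uv (inject₁ i) , inducedMap-path u v uv (suc i) }
    }

module _ {W : Set} {F : Graph W} where

  record TensorVertex (A B : ColouredGraph F) : Set where
    constructor pair
    field
      fst         : Vertex A
      snd         : Vertex B
      same-colour : map (colouring A) fst ≡ map (colouring B) snd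

  open TensorVertex

  tensorGraph : (A B : ColouredGraph F) → Graph (TensorVertex A B)
  tensorGraph A B = record
    { Adj    = λ x y → Adj (graph A) (fst x) (fst y) × Adj (graph B) (snd x) (snd y)
    ; symm   = λ (p , q) → symm (graph A) p , symm (graph B) q
    ; irrefl = λ { x≡y (p , _) → irrefl (graph A) (cong fst x≡y) p }
    ; adj?   = λ x y → adj? (graph A) (fst x) (fst y) ×-dec adj? (graph B) (snd x) (snd y)
    }

  infixr 7 _⊗_
  _⊗_ : ColouredGraph F → ColouredGraph F → ColouredGraph F
  A ⊗ B = coloured (tensorGraph A B) record
    { map      = map (colouring A) ∘ fst
    ; preserve = λ (p , _) → preserve (colouring A) p
    }

-- A partition into finitely many nonempty blocks, given by assigning to each
-- element the block containing it.
record Partition (A : Set) : Set where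
  field
    size     : ℕ
    block    : A → Fin size
    nonempty : StrictlySurjective _≡_ block

open Partition

-- An edge incident to v is determined by its other endpoint; irrelevance
-- ensures that there is only one such edge for each neighbour.
record IncidentEdge {V : Set} (F : Graph V) (v : V) : Set where
  constructor to
  field
    other : V
    .adj  : Adj F v other

Fracture : {V : Set} → Graph V → Set
Fracture {V} F = (v : V) → Partition (IncidentEdge F v)

module _ {V : Set} (F : Graph V) (ρ : Fracture F) where

  FracturedVertex : Set
  FracturedVertex = Σ[ v ∈ V ] Fin (size (ρ v))

  FracturedAdj : FracturedVertex → FracturedVertex → Set
  FracturedAdj (v , B) (u , B′) =
    Σ[ vu ∈ Adj F v u ] (block (ρ v) (to u vu) ≡ B × block (ρ u) (to v (symm F vu)) ≡ B′)

  fractured-adj? : Decidable FracturedAdj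
  fractured-adj? (v , B) (u , B′) with adj? F v u
  ... | no ¬vu = no (¬vu ∘ proj₁)
  ... | yes vu = map′ (vu ,_) proj₂
    ((block (ρ v) (to u vu) ≟ B) ×-dec (block (ρ u) (to v (symm F vu)) ≟ B′))

  infixl 19 _♯_
  _♯_ : Graph FracturedVertex
  _♯_ = record
    { Adj    = FracturedAdj
    ; symm   = λ (vu , p , q) → symm F vu , q , p
    ; irrefl = λ { x≡y (vu , _) → irrefl F (cong proj₁ x≡y) vu }
    ; adj?   = fractured-adj?
    }

  fractureColouring : Hom _♯_ F
  fractureColouring = record { map = proj₁ ; preserve = proj₁ }

-- The fracture cuts the path of Gʳ over each edge {u , v} of G into pieces.
-- A piece is sent, each vertex keeping its position, into the path of an edge
-- of the complete graph from a vertex (u , s , _) to a vertex (v , t , _),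
-- where s and t name the cuts bounding the piece, or are zero where the piece
-- reaches an end of the path. A vertex lying over u itself is sent to
-- (u , 0 , j), where j is an edge of H at c u identifying its block; this also
-- supplies the third coordinates above. There are n (r + 1) k such triples.

module Submission where

open import Defs
open import Data.Bool using (Bool; true; false; if_then_else_)
open import Data.Bool.Properties using (if-float)
open import Data.Nat using (ℕ; zero; suc; _*_; _≤_)
open import Data.Nat.Properties using (≤-reflexive; *-comm)
open import Data.Fin as Fin using (Fin; zero; suc; fromℕ; inject₁; opposite; punchIn; combine; _<?_)
open import Data.Fin.Properties
  using (<-cmp; <-asym; <⇒≢; opposite-involutive; suc-injective; punchIn-injective; punchInᵢ≢i;
         combine-injective; combine-monoˡ-<)
open import Data.Fin.Relation.Unary.Top using (View; view; ‵fromℕ; ‵inject₁)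
open import Data.List using (allFin; cartesianProduct; filter)
open import Data.List.Membership.Propositional using (_∈_)
open import Data.List.Membership.Propositional.Properties
  using (∈-filter⁺; ∈-cartesianProduct⁺; ∈-allFin)
open import Data.List.Membership.Setoid.Properties using (index-injective)
open import Data.List.Relation.Unary.Any using (index)
open import Data.Product using (Σ-syntax; ∃-syntax; _×_; _,_; proj₁; proj₂)
open import Data.Sum using (_⊎_; inj₁; inj₂)
open import Data.Vec.Functional using (Vector)
open import Function using (_∘_)
open import Relation.Binary.Definitions using (Tri; tri<; tri≈; tri>)
open import Relation.Binary.PropositionalEquality
  using (_≡_; _≢_; refl; sym; trans; cong; subst; setoid)
open import Relation.Nullary using (Dec; yes; no; does; contradiction; contradiction-irr; map′; _×-dec_)
open import Relation.Nullary.Decidable using (recompute; dec-true)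

open Graph
open Hom
open Partition
open ColouredGraph

-- Cuts bounding the pieces of a path

-- A path with r + 1 edges is cut at its i-th internal vertex unless J i.
-- start and finish give the cuts bounding the piece that contains a given edge:
-- suc i is the cut at the i-th internal vertex, zero is an end of the path.
start : ∀ {r} → (Fin r → Bool) → Fin (suc r) → Fin (suc r)
start         J zero    = zero
start {suc r} J (suc i) = (if J zero then punchIn (suc zero) else suc) (start (J ∘ suc) i)

finish : ∀ {r} → (Fin r → Bool) → Fin (suc r) → Fin (suc r)
finish {zero}  J zero    = zero
finish {suc r} J zero    = if J zero then punchIn (suc zero) (finish (J ∘ suc) zero) else suc zero
finish {suc r} J (suc i) = punchIn (suc zero) (finish (J ∘ suc) i)

-- Later cuts are renumbered alike whether or not the first vertex is cut, since
-- `punchIn (suc zero)` and `suc` agree on nonzero values.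
start-suc : ∀ {r} (J : Fin r → Bool) i →
            start J (suc i) ≡ (if J i then start J (inject₁ i) else suc i)
start-suc {suc r} J zero with J zero
... | true  = refl
... | false = refl
start-suc {suc r} J (suc i) rewrite start-suc (J ∘ suc) i with J (suc i) | J zero
... | true  | _     = refl
... | false | true  = refl
... | false | false = refl

-- A piece starts before each of its edges. So `suc i` is free to mark, in `startAt`, a block
-- without the edge before the vertex.
start-inject₁≢suc : ∀ {r} (J : Fin r → Bool) i → start J (inject₁ i) ≢ suc i
start-inject₁≢suc {suc r} J (suc i) eq with J zero
... | true  = start-inject₁≢suc (J ∘ suc) i (punchIn-injective (suc zero) _ (suc i) eq)
... | false = start-inject₁≢suc (J ∘ suc) i (suc-injective eq)

finish-fromℕ : ∀ {r} (J : Fin r → Bool) → finish J (fromℕ r) ≡ zero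
finish-fromℕ {zero}  J = refl
finish-fromℕ {suc r} J = cong (punchIn (suc zero)) (finish-fromℕ (J ∘ suc))

finish-inject₁ : ∀ {r} (J : Fin r → Bool) i →
                 finish J (inject₁ i) ≡ (if J i then finish J (suc i) else suc i)
finish-inject₁ {suc r} J zero    = refl
finish-inject₁ {suc r} J (suc i) =
  trans (cong (punchIn (suc zero)) (finish-inject₁ (J ∘ suc) i))
        (if-float (punchIn (suc zero)) (J (suc i)))

finish-suc≢suc : ∀ {r} (J : Fin r → Bool) i → finish J (suc i) ≢ suc i
finish-suc≢suc {suc r} J zero    eq = punchInᵢ≢i (suc zero) _ eq
finish-suc≢suc {suc r} J (suc i) eq =
  finish-suc≢suc (J ∘ suc) i (punchIn-injective (suc zero) _ (suc i) eq)

module _ {A P : Set} where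

  if-dec-true : (p? : Dec P) → P → {x y : A} → (if does p? then x else y) ≡ x
  if-dec-true p? p rewrite dec-true p? p = refl

  -- By `P` the common value is `x`, which a failing second test would not give.
  if-dec-injective : {Q : Set} (p? : Dec P) (q? : Dec Q) {x y : A} → x ≢ y →
                     (if does p? then x else y) ≡ (if does q? then x else y) → P → Q
  if-dec-injective p?      (yes q) _   _  _ = q
  if-dec-injective (yes _) (no _)  x≢y eq _ = contradiction eq x≢y
  if-dec-injective (no ¬p) (no _)  _   _  p = contradiction p ¬p

-- Blocks of a fracture along a walk

module Blocks {V : Set} {F : Graph V} (ρ : Fracture F) where

  _∋_ : FracturedVertex F ρ → V → Set
  (x , B) ∋ y = Σ[ xy ∈ Adj F x y ] block (ρ x) (to y xy) ≡ B

  _∋?_ : ∀ z y → Dec (z ∋ y)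
  (x , B) ∋? y with adj? F x y
  ... | no ¬xy = no (¬xy ∘ proj₁)
  ... | yes xy = map′ (xy ,_) proj₂ (block (ρ x) (to y xy) Fin.≟ B)

  ∋-unique : ∀ {z z′ y} → proj₁ z ≡ proj₁ z′ → z ∋ y → z′ ∋ y → z ≡ z′
  ∋-unique refl (_ , refl) (_ , refl) = refl

  ∋-nonempty : ∀ z → ∃[ y ] z ∋ y
  ∋-nonempty (x , B) with nonempty (ρ x) B
  ... | to y xy , eq = y , recompute (adj? F x y) xy , eq

  module Pieces {r} (q : Vector V (suc (suc r)))
                .(step : ∀ s → Adj F (q (inject₁ s)) (q (suc s))) where

    -- The ends of the edge of `F ♯ ρ` that lies over step `s` of `q`.
    outgoing incoming : Fin (suc r) → FracturedVertex F ρ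
    outgoing s = q (inject₁ s) , block (ρ _) (to (q (suc s)) (step s))
    incoming s = q (suc s) , block (ρ _) (to (q (inject₁ s)) (symm F (step s)))

    outgoing-∋ : ∀ s → outgoing s ∋ q (suc s)
    outgoing-∋ s = recompute (adj? F _ _) (step s) , refl

    incoming-∋ : ∀ s → incoming s ∋ q (inject₁ s)
    incoming-∋ s = recompute (adj? F _ _) (symm F (step s)) , refl

    before after : Fin r → V
    before i = q (inject₁ (inject₁ i))
    after  i = q (suc (suc i))

    opaque

      -- An internal vertex is uncut when one block holds both of its edges on the walk. The two
      -- definitions test this from opposite sides.
      starts finishes : Fin (suc r) → Fin (suc r)
      starts   = start  λ i → does (outgoing (suc i) ∋? before i)
      finishes = finish λ i → does (incoming (inject₁ i) ∋? after i)

      starts-zero : starts zero ≡ zero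
      starts-zero = refl

      finishes-fromℕ : finishes (fromℕ r) ≡ zero
      finishes-fromℕ = finish-fromℕ _

      -- The cuts bounding the piece of a vertex over the i-th internal vertex.
      startAt finishAt : Fin r → FracturedVertex F ρ → Fin (suc r)
      startAt  i z = if does (z ∋? before i) then starts (inject₁ i) else suc i
      finishAt i z = if does (z ∋? after i) then finishes (suc i) else suc i

      startAt-incoming : ∀ i {z} → z ∋ before i → startAt i z ≡ starts (inject₁ i)
      startAt-incoming i {z} z∋ = if-dec-true (z ∋? before i) z∋

      -- Here `z` is `outgoing (suc i)`, so `startAt` makes the same test as `starts` does at this
      -- vertex.
      startAt-outgoing : ∀ i {z} → q (suc (inject₁ i)) ≡ proj₁ z → z ∋ after i →
                         startAt i z ≡ starts (suc i)
      startAt-outgoing i q≡ z∋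
        rewrite ∋-unique (sym q≡) z∋ (outgoing-∋ (suc i)) = sym (start-suc _ i)

      finishAt-outgoing : ∀ i {z} → z ∋ after i → finishAt i z ≡ finishes (suc i)
      finishAt-outgoing i {z} z∋ = if-dec-true (z ∋? after i) z∋

      finishAt-incoming : ∀ i {z} → q (suc (inject₁ i)) ≡ proj₁ z → z ∋ before i →
                          finishAt i z ≡ finishes (inject₁ i)
      finishAt-incoming i q≡ z∋
        rewrite ∋-unique (sym q≡) z∋ (incoming-∋ (inject₁ i)) = sym (finish-inject₁ _ i)

      -- If `z` holds the edge before, `startAt i z` is not the marker `suc i`; equality forces that
      -- edge into `z′` too, and an edge fixes its block. `finishAt` does the same for the edge
      -- after.
      pieces-injective : ∀ i {z z′} → proj₁ z ≡ proj₁ z′ → z ∋ before i ⊎ z ∋ after i →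
                         startAt i z ≡ startAt i z′ → finishAt i z ≡ finishAt i z′ → z ≡ z′
      pieces-injective i {z} {z′} z≡ (inj₁ z∋) starts≡ _ = ∋-unique z≡ z∋
        (if-dec-injective (z ∋? before i) (z′ ∋? before i) (start-inject₁≢suc _ i) starts≡ z∋)
      pieces-injective i {z} {z′} z≡ (inj₂ z∋) _ finishes≡ = ∋-unique z≡ z∋
        (if-dec-injective (z ∋? after i) (z′ ∋? after i) (finish-suc≢suc _ i) finishes≡ z∋)

-- Edges of a graph and adjacency in its subdivision

module _ {n} (G : Graph (Fin n)) where

  edgeBetween : ∀ u v → .(Adj G u v) → Edge G
  edgeBetween u v uv with <-cmp u v
  ... | tri< u<v _ _ = edge u v u<v uv
  ... | tri≈ _ u≡v _ = contradiction-irr uv (irrefl G u≡v)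
  ... | tri> _ _ v<u = edge v u v<u (symm G uv)

  edgeBetween-injective : ∀ u {v w} .(uv : Adj G u v) .(uw : Adj G u w) →
                          edgeBetween u v uv ≡ edgeBetween u w uw → v ≡ w
  edgeBetween-injective u {v} {w} uv uw eq with <-cmp u v | <-cmp u w
  ... | tri≈ _ u≡v _ | _            = contradiction-irr uv (irrefl G u≡v)
  ... | _            | tri≈ _ u≡w _ = contradiction-irr uw (irrefl G u≡w)
  ... | tri< _ _ _   | tri< _ _ _   = cong Edge.tgt eq
  -- With opposite orientations the equation makes `u` equal to both `v` and `w`.
  ... | tri< _ _ _   | tri> _ _ _   = trans (cong Edge.tgt eq) (cong Edge.src eq)
  ... | tri> _ _ _   | tri< _ _ _   = trans (cong Edge.src eq) (cong Edge.tgt eq)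
  ... | tri> _ _ _   | tri> _ _ _   = cong Edge.src eq

  edge-∈ : (e : Edge G) → (Edge.src e , Edge.tgt e) ∈
           filter (λ (u , v) → (u <? v) ×-dec adj? G u v) (cartesianProduct (allFin n) (allFin n))
  edge-∈ (edge a b a<b ab) =
    ∈-filter⁺ (λ (u , v) → (u <? v) ×-dec adj? G u v)
      (∈-cartesianProduct⁺ (∈-allFin a) (∈-allFin b))
      (recompute (a <? b) a<b , recompute (adj? G a b) ab)

  edgeIndex : Edge G → Fin ∣E G ∣
  edgeIndex e = index (edge-∈ e)

  edgeIndex-injective : ∀ {e f} → edgeIndex e ≡ edgeIndex f → e ≡ f
  edgeIndex-injective {e@(edge _ _ _ _)} {f@(edge _ _ _ _)} eq
    with refl ← index-injective (setoid _) (edge-∈ e) (edge-∈ f) eq = refl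

  module _ {r : ℕ} where

    internal-< : ∀ {u v} (u<v : u Fin.< v) .(uv : Adj G u v) (i : Fin r) →
                 internal G u v uv i ≡ sub (edge u v u<v uv) i
    internal-< {u} {v} u<v uv i with <-cmp u v
    ... | tri< _ _ _   = refl
    ... | tri≈ _ u≡v _ = contradiction u≡v (<⇒≢ u<v)
    ... | tri> _ _ v<u = contradiction v<u (<-asym u<v)

    -- An internal vertex records its edge and position, and forgets only the direction of travel.
    internal-≡ : ∀ u v u′ v′ .(uv : Adj G u v) .(uv′ : Adj G u′ v′) {i j : Fin r} →
                 internal G u v uv i ≡ internal G u′ v′ uv′ j →
                 (u ≡ u′ × v ≡ v′ × i ≡ j) ⊎ (u ≡ v′ × v ≡ u′ × opposite i ≡ j)
    internal-≡ u v u′ v′ uv uv′ eq with <-cmp u v | <-cmp u′ v′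
    internal-≡ u v u′ v′ uv uv′ eq   | tri≈ _ u≡v _ | _            = contradiction-irr uv (irrefl G u≡v)
    internal-≡ u v u′ v′ uv uv′ eq   | _            | tri≈ _ u≡v _ = contradiction-irr uv′ (irrefl G u≡v)
    internal-≡ u v u′ v′ uv uv′ refl | tri< _ _ _   | tri< _ _ _   = inj₁ (refl , refl , refl)
    internal-≡ u v u′ v′ uv uv′ refl | tri< _ _ _   | tri> _ _ _   = inj₂ (refl , refl , opposite-involutive _)
    internal-≡ u v u′ v′ uv uv′ eq   | tri> _ _ _   | tri< _ _ _ with refl ← eq = inj₂ (refl , refl , refl)
    internal-≡ u v u′ v′ uv uv′ {i} {j} eq | tri> _ _ _ | tri> _ _ _
      -- The value at `orig` is arbitrary: both sides are `sub`.
      with refl ← cong (λ { (sub e _) → Edge.src e , Edge.tgt e ; (orig x) → x , x }) eq =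
      inj₁ (refl , refl , trans (sym (opposite-involutive i))
        (trans (cong opposite (sub-injectiveʳ G eq)) (opposite-involutive j)))

    path-internal : ∀ u v .(uv : Adj G u v) (i : Fin r) →
                    path G u v uv (suc (inject₁ i)) ≡ internal G u v uv i
    path-internal u v uv = ∷ʳ-inject₁ (internal G u v uv) (orig v)

    path-end : ∀ u v .(uv : Adj G u v) → path G u v uv (suc (fromℕ r)) ≡ orig v
    path-end u v uv = ∷ʳ-fromℕ (internal G u v uv) (orig v)

    path-step : ∀ u v (uv : Adj G u v) i →
                Adj (G ^ r) (path G u v uv (inject₁ i)) (path G u v uv (suc i))
    path-step u v uv i = u , v , uv , i , refl , refl

    orig-neighbour : ∀ {v y} → Adj (G ^ r) (orig v) y →
                     ∃[ w ] Σ[ vw ∈ Adj G v w ] y ≡ path G v w vw (suc zero)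
    orig-neighbour (u , w , uw , zero  , refl , y≡) = w , uw , y≡
    orig-neighbour (u , w , uw , suc i , x≡   , _)  =
      contradiction (trans x≡ (path-internal u w uw i)) (orig≢internal G u w uw i)

    internal-neighbours : ∀ u v .(uv : Adj G u v) i {y} → Adj (G ^ r) (internal G u v uv i) y →
                          y ≡ path G u v uv (inject₁ (inject₁ i)) ⊎ y ≡ path G u v uv (suc (suc i))
    internal-neighbours u v uv i (u′ , v′ , uv′ , zero  , x≡ , _)  =
      contradiction (sym x≡) (orig≢internal G u v uv i)
    internal-neighbours u v uv i (u′ , v′ , uv′ , suc j , x≡ , y≡)
      with internal-≡ u v u′ v′ uv uv′ (trans x≡ (path-internal u′ v′ uv′ j))
    ... | inj₁ (refl , refl , refl) = inj₂ y≡
    -- The edge is traversed backwards here, so the next vertex is the one before `i` on the path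
    -- from `u`.
    ... | inj₂ (refl , refl , refl) = inj₁ (trans y≡
      (trans (sym (path-opposite G u v uv (suc (suc (opposite i)))))
             (cong (λ k → path G u v uv (inject₁ (inject₁ k))) (opposite-involutive i))))

-- Naming the blocks at original vertices

module _ {m r} (H : Graph (Fin m)) (ρ : Fracture (H ^ r)) where

  open Blocks ρ

  neighbour : ∀ {v} (z : FracturedVertex (H ^ r) ρ) → orig v ≡ proj₁ z →
              ∃[ w ] Σ[ vw ∈ Adj H v w ] z ∋ path H v w vw (suc zero)
  neighbour {v} z refl with ∋-nonempty z
  ... | y , z∋y with orig-neighbour H {v = v} {y} (proj₁ z∋y)
  ... | w , vw , refl = w , vw , z∋y

  opaque

    -- An edge of H at v lying in the block z names that block.
    port : ∀ {v} (z : FracturedVertex (H ^ r) ρ) → orig v ≡ proj₁ z → Fin ∣E H ∣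
    port {v} z v≡ = let w , vw , _ = neighbour z v≡ in edgeIndex H (edgeBetween H v w vw)

    -- Equal indices give the same edge of `H` at `v`, so both blocks hold the first edge of the
    -- same path.
    port-injective : ∀ {v z z′} (v≡ : orig v ≡ proj₁ z) (v≡′ : orig v ≡ proj₁ z′) →
                     port z v≡ ≡ port z′ v≡′ → z ≡ z′
    port-injective {v} {z} {z′} v≡ v≡′ eq with neighbour z v≡ | neighbour z′ v≡′
    ... | w , vw , z∋ | w′ , vw′ , z′∋
      with refl ← edgeBetween-injective H v vw vw′ (edgeIndex-injective H eq) =
      ∋-unique (trans (sym v≡) v≡′) z∋ z′∋

    port-cong : ∀ {v z z′} (v≡ : orig v ≡ proj₁ z) (v≡′ : orig v ≡ proj₁ z′) →
                z ≡ z′ → port z v≡ ≡ port z′ v≡′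
    port-cong refl refl refl = refl

-- The map into the subdivided complete graph

module _ {m n} r {G : Graph (Fin n)} {H : Graph (Fin m)} (c : Hom G H) (ρ : Fracture (H ^ r)) where

  open Blocks ρ

  product : ColouredGraph (H ^ r)
  product = coloured (G ^ r) (inducedColouring c r)
              ⊗ coloured ((H ^ r) ♯ ρ) (fractureColouring (H ^ r) ρ)

  order : ℕ
  order = n * (suc r * ∣E H ∣)

  K : Graph (Fin order)
  K = complete order

  private
    module P u v .(uv : Adj G u v) =
      Pieces (path H (map c u) (map c v) (preserve c uv))
             (path-step H (map c u) (map c v) (preserve c uv))

  opaque

    code : Fin n → Fin (suc r) → Fin ∣E H ∣ → Fin order
    code u s j = combine u (combine s j)

    code-injective : ∀ {u u′ s s′ j j′} → code u s j ≡ code u′ s′ j′ → u ≡ u′ × s ≡ s′ × j ≡ j′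
    code-injective eq =
      let u≡ , sj≡ = combine-injective _ _ _ _ eq
          s≡ , j≡  = combine-injective _ _ _ _ sj≡
      in u≡ , s≡ , j≡

    -- `combine` is lexicographic, so the vertex of `G` decides the order. Edges thus keep their
    -- orientation, and `embed` can keep the position `i`.
    code-mono-< : ∀ {u v} → u Fin.< v → ∀ {s t j k} → code u s j Fin.< code v t k
    code-mono-< u<v = combine-monoˡ-< _ _ u<v

  module _ u v .(uv : Adj G u v) where

    -- The port is that of the block holding the first or last edge of the path, so at `zero` this
    -- is the code of the fractured vertex over that end.
    source target : Fin (suc r) → Fin order
    source s = code u s (port H ρ (P.outgoing u v uv zero) refl)
    target t = code v t (port H ρ (P.incoming u v uv (fromℕ r)) (sym (path-end H _ _ (preserve c uv))))

  source<target : ∀ {u v} .(uv : Adj G u v) → u Fin.< v → ∀ {s t} →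
                  source u v uv s Fin.< target u v uv t
  source<target uv u<v = code-mono-< u<v

  embed : Vertex product → SubdivisionVertex K r
  embed (pair (orig u) z v≡) = orig (code u zero (port H ρ z v≡))
  embed (pair (sub (edge u v u<v uv) i) z _) =
    sub (edge (source u v uv (P.startAt u v uv i z)) (target u v uv (P.finishAt u v uv i z))
              (source<target uv u<v) (<⇒≢ (source<target uv u<v))) i

  -- Preservation of adjacency

  module _ {u v} (u<v : u Fin.< v) (uv : Adj G u v) where

    open P u v uv

    -- The path receiving the piece that contains edge `s`; both ends of that edge are shown to land
    -- on it.
    image : Fin (suc r) → Vector (SubdivisionVertex K r) (suc (suc r))
    image s = path K (source u v uv (starts s)) (target u v uv (finishes s))
                     (<⇒≢ (source<target uv u<v))

    piece-cong : ∀ {s s′ t t′} {i : Fin r} → s ≡ s′ → t ≡ t′ →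
                 sub {G = K} (edge (source u v uv s) (target u v uv t) (source<target uv u<v)
                                   (<⇒≢ (source<target uv u<v))) i ≡
                 sub (edge (source u v uv s′) (target u v uv t′) (source<target uv u<v)
                           (<⇒≢ (source<target uv u<v))) i
    piece-cong refl refl = refl

    embed-internal : ∀ i z v≡ s → startAt i z ≡ starts s → finishAt i z ≡ finishes s →
                     embed (pair (sub (edge u v u<v uv) i) z v≡) ≡ image s (suc (inject₁ i))
    embed-internal i z v≡ s starts≡ finishes≡ = trans (piece-cong starts≡ finishes≡)
      (sym (trans (path-internal K (source u v uv (starts s)) (target u v uv (finishes s)) s≢t i)
                  (internal-< K (source<target uv u<v) s≢t i)))
      where
      s≢t : source u v uv (starts s) ≢ target u v uv (finishes s)
      s≢t = <⇒≢ (source<target uv u<v)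

    colour-internal : ∀ (i : Fin r) {z : FracturedVertex (H ^ r) ρ} →
                      internal H (map c u) (map c v) (preserve c uv) i ≡ proj₁ z →
                      path H (map c u) (map c v) (preserve c uv) (suc (inject₁ i)) ≡ proj₁ z
    colour-internal i = trans (path-internal H (map c u) (map c v) (preserve c uv) i)

    -- At the first vertex `z` is `outgoing zero`, whose port `source` uses. At an internal vertex
    -- the cuts bounding `z` are those bounding the edge that leaves it.
    embed-tail : ∀ s {x z} v≡ → x ≡ path G u v uv (inject₁ s) →
                 z ∋ path H (map c u) (map c v) (preserve c uv) (suc s) →
                 embed (pair x z v≡) ≡ image s (inject₁ s)
    embed-tail zero v≡ refl z∋ = trans
      (cong (orig ∘ code u zero)
        (port-cong H ρ v≡ refl (∋-unique (sym v≡) z∋ (outgoing-∋ zero))))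
      (cong (orig ∘ source u v uv) (sym starts-zero))
    embed-tail (suc i) {z = z} v≡ x≡ z∋
      with refl ← trans x≡ (trans (path-internal G u v uv i) (internal-< G u<v uv i)) =
      embed-internal i _ v≡ (suc i)
        (startAt-outgoing i (colour-internal i {z} v≡) z∋) (finishAt-outgoing i z∋)

    -- The split is on the last edge, the only one whose head is an original vertex.
    embed-head : ∀ {s} → View s → ∀ {x z} v≡ → x ≡ path G u v uv (suc s) →
                 z ∋ path H (map c u) (map c v) (preserve c uv) (inject₁ s) →
                 embed (pair x z v≡) ≡ image s (suc s)
    embed-head ‵fromℕ v≡ x≡ z∋ with refl ← trans x≡ (path-end G u v uv) = trans
      (cong (orig ∘ code v zero)
        (port-cong H ρ v≡ (sym end) (∋-unique (trans (sym v≡) (sym end)) z∋ (incoming-∋ (fromℕ r)))))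
      (sym (trans (path-end K (source u v uv (starts (fromℕ r))) (target u v uv (finishes (fromℕ r)))
                            (<⇒≢ (source<target uv u<v)))
                  (cong (orig ∘ target u v uv) finishes-fromℕ)))
      where
      end : path H (map c u) (map c v) (preserve c uv) (suc (fromℕ r)) ≡ orig (map c v)
      end = path-end H (map c u) (map c v) (preserve c uv)
    embed-head (‵inject₁ i) {z = z} v≡ x≡ z∋
      with refl ← trans x≡ (trans (path-internal G u v uv i) (internal-< G u<v uv i)) =
      embed-internal i _ v≡ (inject₁ i)
        (startAt-incoming i z∋) (finishAt-incoming i (colour-internal i {z} v≡) z∋)

    embed-preserves-< : ∀ s {x x′ z z′} v≡ v≡′ →
                        x ≡ path G u v uv (inject₁ s) → x′ ≡ path G u v uv (suc s) →
                        FracturedAdj (H ^ r) ρ z z′ →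
                        Adj (K ^ r) (embed (pair x z v≡)) (embed (pair x′ z′ v≡′))
    embed-preserves-< s {z = z} {z′} v≡ v≡′ refl refl (zz′ , z∋ , z′∋) =
      _ , _ , <⇒≢ (source<target uv u<v) , s ,
      embed-tail s v≡ refl
        (subst (z ∋_) (trans (sym v≡′) (inducedMap-path c r u v uv (suc s))) (zz′ , z∋)) ,
      embed-head (view s) v≡′ refl
        (subst (z′ ∋_) (trans (sym v≡) (inducedMap-path c r u v uv (inject₁ s)))
          (symm (H ^ r) zz′ , z′∋))

  embed-preserves : ∀ {p p′} → Adj (graph product) p p′ → Adj (K ^ r) (embed p) (embed p′)
  embed-preserves {pair x z v≡} {pair x′ z′ v≡′} ((u , v , uv , s , x≡ , x′≡) , zz′) =
    oriented (<-cmp u v)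
    where
    oriented : Tri (u Fin.< v) (u ≡ v) (v Fin.< u) →
               Adj (K ^ r) (embed (pair x z v≡)) (embed (pair x′ z′ v≡′))
    oriented (tri< u<v _ _) = embed-preserves-< u<v uv s v≡ v≡′ x≡ x′≡ zz′
    oriented (tri≈ _ u≡v _) = contradiction uv (irrefl G u≡v)
    -- Images are built along increasing edges, so the adjacency is reversed first.
    oriented (tri> _ _ v<u) =
      let _ , _ , vu , t , x′≡ , x≡ = symm (G ^ r) (u , v , uv , s , x≡ , x′≡)
      in symm (K ^ r) {embed (pair x′ z′ v≡′)}
           (embed-preserves-< v<u vu t v≡′ v≡ x′≡ x≡ (symm ((H ^ r) ♯ ρ) zz′))

  -- Injectivity and the bound

  -- Blocks are nonempty, and an internal vertex has only two neighbours.
  ∋-before⊎after : ∀ u v .(uv : Adj G u v) i {z : FracturedVertex (H ^ r) ρ} →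
                   internal H (map c u) (map c v) (preserve c uv) i ≡ proj₁ z →
                   z ∋ P.before u v uv i ⊎ z ∋ P.after u v uv i
  ∋-before⊎after u v uv i {z} refl with ∋-nonempty z
  ... | y , z∋y with internal-neighbours H (map c u) (map c v) (preserve c uv) i {y} (proj₁ z∋y)
  ... | inj₁ refl = inj₁ z∋y
  ... | inj₂ refl = inj₂ z∋y

  tensor-vertex-≡ : {p p′ : Vertex product} → TensorVertex.fst p ≡ TensorVertex.fst p′ →
                    TensorVertex.snd p ≡ TensorVertex.snd p′ → p ≡ p′
  tensor-vertex-≡ {pair _ _ refl} {pair _ _ refl} refl refl = refl

  embed-injective : ∀ {p p′} → embed p ≡ embed p′ → p ≡ p′
  embed-injective {pair (orig u) z v≡} {pair (orig u′) z′ v≡′} eq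
    with refl , _ , port≡ ← code-injective (orig-injective K eq) =
    tensor-vertex-≡ refl (port-injective H ρ v≡ v≡′ port≡)
  embed-injective {pair (sub (edge u v _ uv) i) z v≡} {pair (sub (edge u′ v′ _ uv′) i′) z′ v≡′} eq
    with e≡ ← cong (λ { (sub e _) → Edge.src e , Edge.tgt e ; (orig x) → x , x }) eq
    -- The ends of the edge give `u`, `v` and both cuts; these determine the block, so the ports are
    -- dropped.
    with refl , starts≡ , _   ← code-injective (cong proj₁ e≡)
       | refl , finishes≡ , _ ← code-injective (cong proj₂ e≡)
       | refl ← sub-injectiveʳ K eq =
    tensor-vertex-≡ refl
      (P.pieces-injective u v uv i (trans (sym v≡) v≡′) (∋-before⊎after u v uv i v≡) starts≡ finishes≡)

lemma34 : (r : ℕ) →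
    ∃[ C ] (∀ {m n} (H : Graph (Fin m)) → NoIsolatedVertices H →
    (G : Graph (Fin n)) (c : Hom G H) (ρ : Fracture (H ^ r)) →
    ∃[ N ] (N ≤ C * ∣E H ∣ * n ×
    ColouredGraph.graph
    (coloured (G ^ r) (inducedColouring c r)
    ⊗ coloured ((H ^ r) ♯ ρ) (fractureColouring (H ^ r) ρ))
    ⊑ (complete N ^ r)))
-- The constant counts the values of a cut: `r` internal vertices and `zero`.
lemma34 r = suc r , λ {_} {n} H _ G c ρ →
  order r c ρ , ≤-reflexive (*-comm n (suc r * ∣E H ∣)) ,
  record { map = embed r c ρ ; preserve = embed-preserves r c ρ } , embed-injective r c ρ
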